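{- Let $\mathcal{H}$ be a family of graphs. There is a constant $C=C(\mathcal{H})$ such that $$\#\{v\in V(G):\operatorname{adh}(v)\ge 2\}\le C$$ for every connected $\mathcal{H}$-free graph $G$ if and only if $$\mathcal{H}\le \{K_n^*,\ K_{1,n}^*,\ P_n\}$$ for some positive integer $n$.
   Context: All graphs are finite, undirected and simple. For graphs $H_1,H_2$, write $H_1\le H_2$ if $H_1$ is (isomorphic to) an induced subgraph of $H_2$. A graph $G$ is $\mathcal{H}$-free if there is no $H\in\mathcal{H}$ with $H\le G$. For families of graphs $\mathcal{H}_1,\mathcal{H}_2$, write $\mathcal{H}_1\le\mathcal{H}_2$ if for every $H_2\in\mathcal{H}_2$ there is $H_1\in\mathcal{H}_1$ with $H_1\le H_2$. For a graph $G$, $c(G)$ is its number of connected components. The adhesion of a vertex $v$ of $G$ is $\operatorname{adh}(v)=c(G-v)-c(G)+1$ (so $v$ is a cut vertex if and only if $\operatorname{adh}(v)\ge 2$). $K_n$ is the complete graph on $n$ vertices and $P_n$ the path on $n$ vertices. $K_{1,n}^*$ is obtained from the star $K_{1,n}$ by attaching one pendant vertex to each of its $n$ leaves. $K_n^*$ is obtained from $K_n$ by attaching one pendant vertex to every vertex of $K_n$. -}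

module Defs where

open import Data.Bool using (Bool; true; false; T; not; _∨_)
open import Data.Bool.Properties using (∨-comm; T?)
open import Data.Fin using (Fin; zero; suc; toℕ; punchIn; splitAt; _≟_)
open import Data.Integer as ℤ using (ℤ; +_)
open import Data.List using (List; []; _∷_; length; filter; deduplicate; allFin)
open import Data.List.Membership.Propositional using (_∈_)
open import Data.List.Membership.Propositional.Properties using (∈-allFin)
open import Data.List.Relation.Unary.Any using (here; there)
open import Data.Nat as ℕ using (ℕ; zero; suc; _≡ᵇ_)
open import Data.Product using (_×_; _,_; ∃-syntax)
open import Data.Sum using (_⊎_; inj₁; inj₂)
open import Function using (id)
open import Function.Definitions using (Injective)
open import Level using (Level; 0ℓ; _⊔_)
open import Relation.Binary.Construct.Closure.ReflexiveTransitive
  using (Star; ε; _◅_; _◅◅_)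
open import Relation.Binary.Definitions using (Decidable)
open import Relation.Binary.PropositionalEquality
  using (_≡_; refl; sym; cong)
open import Relation.Nullary using (¬_; does; yes; no; contradiction)
open import Relation.Nullary.Decidable using (_×-dec_; _⊎-dec_; map′)
open import Relation.Unary as Pred using (Pred)

private
  variable
    ℓ ℓ₁ ℓ₂ : Level

record Graph : Set where
  field
    order      : ℕ
    adj        : Fin order → Fin order → Bool
    adj-sym    : ∀ u v → adj u v ≡ adj v u
    adj-irrefl : ∀ v → adj v v ≡ false

  Vertex : Set
  Vertex = Fin order

  Adj : Vertex → Vertex → Set
  Adj u v = T (adj u v)

  Reachable : Vertex → Vertex → Set
  Reachable = Star Adj

  -- The null graph counts as connected; it has no cut vertices anyway.
  Connected : Set
  Connected = ∀ u v → Reachable u v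

open Graph using (order; Vertex; Connected)

-- Reachability is decided as in the Floyd–Warshall algorithm: Via xs u v says
-- that some walk from u to v has all its interior vertices in xs.
module _ (G : Graph) where
  open Graph G using (adj; Adj; Reachable)

  private
    Via : List (Vertex G) → Vertex G → Vertex G → Set
    Via []       u v = u ≡ v ⊎ Adj u v
    Via (x ∷ xs) u v = Via xs u v ⊎ (Via xs u x × Via xs x v)

    via? : ∀ xs → Decidable (Via xs)
    via? []       u v = (u ≟ v) ⊎-dec T? (adj u v)
    via? (x ∷ xs) u v = via? xs u v ⊎-dec (via? xs u x ×-dec via? xs x v)

    via-base : ∀ xs {u v} → u ≡ v ⊎ Adj u v → Via xs u v
    via-base []       p = p
    via-base (x ∷ xs) p = inj₁ (via-base xs p)

    via-trans : ∀ {xs u v w} → w ∈ xs → Via xs u w → Via xs w v → Via xs u v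
    via-trans {x ∷ xs} (here refl) p q = inj₂ (into p , outof q)
      where
      into : ∀ {u} → Via (x ∷ xs) u x → Via xs u x
      into (inj₁ r)       = r
      into (inj₂ (r , _)) = r
      outof : ∀ {v} → Via (x ∷ xs) x v → Via xs x v
      outof (inj₁ r)       = r
      outof (inj₂ (_ , r)) = r
    via-trans (there m) (inj₁ p)       (inj₁ q)       = inj₁ (via-trans m p q)
    via-trans (there m) (inj₁ p)       (inj₂ (q , r)) = inj₂ (via-trans m p q , r)
    via-trans (there m) (inj₂ (p , q)) (inj₁ r)       = inj₂ (p , via-trans m q r)
    via-trans (there m) (inj₂ (p , _)) (inj₂ (_ , r)) = inj₂ (p , r)

    via⇒reachable : ∀ xs {u v} → Via xs u v → Reachable u v
    via⇒reachable []       (inj₁ refl)    = ε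
    via⇒reachable []       (inj₂ e)       = e ◅ ε
    via⇒reachable (x ∷ xs) (inj₁ p)       = via⇒reachable xs p
    via⇒reachable (x ∷ xs) (inj₂ (p , q)) =
      via⇒reachable xs p ◅◅ via⇒reachable xs q

    reachable⇒via : ∀ {u v} → Reachable u v → Via (allFin (order G)) u v
    reachable⇒via ε       = via-base (allFin (order G)) (inj₁ refl)
    reachable⇒via (_◅_ {j = w} e p) =
      via-trans (∈-allFin w) (via-base (allFin (order G)) (inj₂ e)) (reachable⇒via p)

  reachable? : Decidable Reachable
  reachable? u v =
    map′ (via⇒reachable (allFin (order G))) reachable⇒via (via? (allFin (order G)) u v)

-- Components are the classes of mutual reachability; deduplication up to
-- reachability keeps exactly one vertex of each.
c : Graph → ℕ
c G = length (deduplicate (reachable? G) (allFin (order G)))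

induce : (G : Graph) {m : ℕ} → (Fin m → Vertex G) → Graph
induce G {m} f = record
  { order      = m
  ; adj        = λ u v → Graph.adj G (f u) (f v)
  ; adj-sym    = λ u v → Graph.adj-sym G (f u) (f v)
  ; adj-irrefl = λ v → Graph.adj-irrefl G (f v)
  }

infixl 6 _-_

_-_ : (G : Graph) → Vertex G → Graph
G@(record { order = suc _ }) - v = induce G (punchIn v)

-- Integer-valued, since deleting an isolated vertex lowers c.
adh : (G : Graph) → Vertex G → ℤ
adh G v = (+ c (G - v)) ℤ.- (+ c G) ℤ.+ (+ 1)

#cutVertices : Graph → ℕ
#cutVertices G = length (filter (λ v → + 2 ℤ.≤? adh G v) (allFin (order G)))

infix 4 _≤ᵍ_ _≤ᶠ_

_≤ᵍ_ : Graph → Graph → Set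
H ≤ᵍ G = ∃[ f ] Injective _≡_ _≡_ f
              × (∀ u v → Graph.adj H u v ≡ Graph.adj G (f u) (f v))

Family : (ℓ : Level) → Set (Level.suc ℓ)
Family ℓ = Pred Graph ℓ

_Free : Family ℓ → Pred Graph ℓ
(𝓗 Free) G = ¬ (∃[ H ] H Pred.∈ 𝓗 × H ≤ᵍ G)

_≤ᶠ_ : Family ℓ₁ → Family ℓ₂ → Set (ℓ₁ ⊔ ℓ₂)
𝓗₁ ≤ᶠ 𝓗₂ = ∀ H₂ → H₂ Pred.∈ 𝓗₂ → ∃[ H₁ ] H₁ Pred.∈ 𝓗₁ × H₁ ≤ᵍ H₂

K : ℕ → Graph
K n = record
  { order      = n
  ; adj        = λ u v → not (does (u ≟ v))
  ; adj-sym    = λ u v → cong not (does-≟-sym u v)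
  ; adj-irrefl = λ v → cong not (does-≟-refl v)
  }
  where
  does-≟-sym : (u v : Fin n) → does (u ≟ v) ≡ does (v ≟ u)
  does-≟-sym u v with u ≟ v | v ≟ u
  ... | yes _ | yes _ = refl
  ... | no _  | no _  = refl
  ... | yes p | no q  = contradiction (sym p) q
  ... | no p  | yes q = contradiction (sym q) p
  does-≟-refl : (v : Fin n) → does (v ≟ v) ≡ true
  does-≟-refl v with v ≟ v
  ... | yes _ = refl
  ... | no p  = contradiction refl p

P : ℕ → Graph
P n = record
  { order      = n
  ; adj        = λ u v → next u v ∨ next v u
  ; adj-sym    = λ u v → ∨-comm (next u v) (next v u)
  ; adj-irrefl = λ v → irrefl (toℕ v)
  }
  where
  next : Fin n → Fin n → Bool
  next u v = suc (toℕ u) ≡ᵇ toℕ v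
  irrefl : ∀ k → (suc k ≡ᵇ k) ∨ (suc k ≡ᵇ k) ≡ false
  irrefl zero    = refl
  irrefl (suc k) = irrefl k

-- The star K_{1,n}: the centre is zero and the leaves are suc i.
K₁ : ℕ → Graph
K₁ n = record
  { order      = suc n
  ; adj        = star
  ; adj-sym    = star-sym
  ; adj-irrefl = λ { zero → refl ; (suc _) → refl }
  }
  where
  star : Fin (suc n) → Fin (suc n) → Bool
  star zero    zero    = false
  star zero    (suc _) = true
  star (suc _) zero    = true
  star (suc _) (suc _) = false
  star-sym : ∀ u v → star u v ≡ star v u
  star-sym zero    zero    = refl
  star-sym zero    (suc _) = refl
  star-sym (suc _) zero    = refl
  star-sym (suc _) (suc _) = refl

-- Adds m new vertices, the j-th of them adjacent to f j only.
attachPendants : (G : Graph) {m : ℕ} → (Fin m → Vertex G) → Graph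
attachPendants G {m} f = record
  { order      = order G ℕ.+ m
  ; adj        = λ u v → adj′ (splitAt (order G) u) (splitAt (order G) v)
  ; adj-sym    = λ u v → adj′-sym (splitAt (order G) u) (splitAt (order G) v)
  ; adj-irrefl = λ v → adj′-irrefl (splitAt (order G) v)
  }
  where
  adj′ : Vertex G ⊎ Fin m → Vertex G ⊎ Fin m → Bool
  adj′ (inj₁ u) (inj₁ v) = Graph.adj G u v
  adj′ (inj₁ u) (inj₂ j) = does (f j ≟ u)
  adj′ (inj₂ i) (inj₁ v) = does (f i ≟ v)
  adj′ (inj₂ _) (inj₂ _) = false
  adj′-sym : ∀ x y → adj′ x y ≡ adj′ y x
  adj′-sym (inj₁ u) (inj₁ v) = Graph.adj-sym G u v
  adj′-sym (inj₁ _) (inj₂ _) = refl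
  adj′-sym (inj₂ _) (inj₁ _) = refl
  adj′-sym (inj₂ _) (inj₂ _) = refl
  adj′-irrefl : ∀ x → adj′ x x ≡ false
  adj′-irrefl (inj₁ v) = Graph.adj-irrefl G v
  adj′-irrefl (inj₂ _) = refl

K* : ℕ → Graph
K* n = attachPendants (K n) id

K₁* : ℕ → Graph
K₁* n = attachPendants (K₁ n) suc

-- Let G be connected, rooted at r, and layered by distance from r. If it has no induced
-- P n, fewer than n levels occur. A cut vertex v has a neighbour v′ that r cannot reach
-- without v, so v′ lies one level below v, and for the cut vertices v of one level the
-- edges v v′ form an induced matching with independent lower ends ("rungs"). By Ramsey's
-- theorem, many rungs contain many whose upper ends form a clique, giving K* n, or an
-- independent set. In the latter case n upper ends with a common parent give K₁* n;
-- otherwise parents and upper ends contain a large induced matching, that is, many rungs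
-- one level higher, and this cannot go on up to r. Conversely, K* n, K₁* n and P n
-- themselves are connected with unboundedly many cut vertices.
module Submission where

open import Defs
open Graph using (Connected)
open import Axiom.ExcludedMiddle using (ExcludedMiddle)
open import Data.Bool using (true; false; T; not)
open import Data.Bool.Properties using (T?; T-∨)
open import Data.Empty using (⊥-elim)
open import Data.Fin
  using (Fin; zero; suc; toℕ; inject≤; inject₁; punchIn; punchOut; splitAt; _↑ˡ_; _↑ʳ_)
import Data.Fin as Fin
open import Data.Fin.Properties
  using (any?; injective⇒≤; inject≤-injective; toℕ-injective; toℕ<n; toℕ-inject₁;
         inject₁-injective; toℕ-fromℕ; ↑ˡ-injective; splitAt⁻¹-↑ˡ; suc-injective;
         punchIn-injective; punchIn-punchOut; punchInᵢ≢i; join-splitAt; splitAt-↑ˡ; splitAt-↑ʳ)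
open import Data.Fin.Induction using (<-weakInduction)
import Data.Integer as ℤ
open import Data.Integer using (+_; +≤+)
import Data.Integer.Properties as ℤₚ
open import Data.List using ([]; _∷_; map; length; filter; lookup; deduplicate; allFin)
open import Data.List.Membership.Propositional using (_∈_; find; lose)
open import Data.List.Membership.Propositional.Properties
  using (∈-allFin; ∈-filter⁺; ∈-filter⁻; ∈-lookup)
open import Data.List.Properties using (length-map; filter-none)
open import Data.List.Relation.Binary.Sublist.Propositional
  using (_⊆_; []; _∷_; _∷ʳ_; ⊆-trans; minimum)
open import Data.List.Relation.Binary.Sublist.Propositional.Properties using (All-resp-⊆; filter-⊆)
open import Data.List.Relation.Unary.All as All using (All; []; _∷_)
import Data.List.Relation.Unary.All.Properties as Allₚ
open import Data.List.Relation.Unary.AllPairs using (AllPairs; []; _∷_)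
import Data.List.Relation.Unary.AllPairs.Properties as AllPairsₚ
open import Data.List.Relation.Unary.Any as Any using (Any; here; there)
open import Data.List.Relation.Unary.Any.Properties using (lookup-index; deduplicate⁺)
open import Data.List.Relation.Unary.Unique.Propositional using (Unique)
import Data.List.Relation.Unary.Unique.Propositional.Properties as Unique
open import Data.Nat as ℕ using (ℕ; zero; suc; _+_; _*_; _≤_; _<_; z≤n; s≤s)
open import Data.Nat.Properties as ℕₚ
  using (≤-refl; ≤-trans; ≤-reflexive; ≤-antisym; ≰⇒>; ≮⇒≥; <-irrefl; module ≤-Reasoning)
open import Data.Product using (_×_; _,_; ∃; ∃₂; Σ-syntax; ∃-syntax; proj₁; proj₂; uncurry)
open import Data.Sum using (_⊎_; inj₁; inj₂; [_,_]′)
open import Data.Unit using (tt)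
open import Function using (_∘_; _on_; id)
open import Function.Bundles using (_⇔_; mk⇔; module Equivalence)
open import Function.Definitions using (Injective)
open import Level using (Level; 0ℓ; Lift; lift; lower)
open import Relation.Binary.Core using (Rel)
open import Relation.Binary.Definitions as Binary using (Symmetric; tri<; tri≈; tri>)
open import Relation.Binary.Construct.Closure.ReflexiveTransitive
  using (Star; ε; _◅_; _◅◅_; reverse)
open import Relation.Binary.PropositionalEquality
  using (_≡_; _≢_; refl; sym; trans; cong; subst; ≢-sym)
open import Relation.Nullary using (¬_; yes; no; does; contradiction; ¬?)
open import Relation.Nullary.Decidable using (map′; decidable-stable; dec-true; _×-dec_)
open import Relation.Unary using (Pred; Decidable; ｛_｝; _∪_)

private
  variable
    a b p r s : Level
    A : Set a
    B : Set b

-- Lists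

allPairs-lookup : {R : Rel A r} → Symmetric R → ∀ {xs} → AllPairs R xs →
                  ∀ {i j} → i ≢ j → R (lookup xs i) (lookup xs j)
allPairs-lookup sy (px ∷ pxs) {zero}  {zero}  i≢j = contradiction refl i≢j
allPairs-lookup sy (px ∷ pxs) {zero}  {suc j} i≢j = All.lookup px (∈-lookup j)
allPairs-lookup sy (px ∷ pxs) {suc i} {zero}  i≢j = sy (All.lookup px (∈-lookup i))
allPairs-lookup sy (px ∷ pxs) {suc i} {suc j} i≢j = allPairs-lookup sy pxs (i≢j ∘ cong suc)

allPairs-∈ : {R : Rel A r} → Symmetric R → ∀ {xs} → AllPairs R xs →
             ∀ {x y} → x ∈ xs → y ∈ xs → x ≢ y → R x y
allPairs-∈ sy {xs} ps {x} {y} x∈ y∈ x≢y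
  rewrite lookup-index x∈ | lookup-index y∈ = allPairs-lookup sy ps (x≢y ∘ cong (lookup xs))

allPairs-resp-⊆ : {R : Rel A r} → ∀ {xs ys} → ys ⊆ xs → AllPairs R xs → AllPairs R ys
allPairs-resp-⊆ []          []         = []
allPairs-resp-⊆ (_ ∷ʳ τ)    (_ ∷ ps)   = allPairs-resp-⊆ τ ps
allPairs-resp-⊆ (refl ∷ τ)  (px ∷ ps)  = All-resp-⊆ τ px ∷ allPairs-resp-⊆ τ ps

allPairs-map : {P : Pred A p} {R : Rel A r} {S : Rel A s} →
               (∀ {x y} → P x → P y → R x y → S x y) →
               ∀ {xs} → All P xs → AllPairs R xs → AllPairs S xs
allPairs-map f []         []         = []
allPairs-map f (px ∷ pxs) (rx ∷ rxs) =
  All.zipWith (λ (py , rxy) → f px py rxy) (pxs , rx) ∷ allPairs-map f pxs rxs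

-- The equation for `xs` is there to be matched with `refl`, which carries all hypotheses on `xs`
-- over to the list of pairs.
chooseAll : {Q : A → B → Set r} → ∀ {xs} → All (λ x → ∃ (Q x)) xs →
            ∃[ ps ] map proj₁ ps ≡ xs × All (uncurry Q) ps
chooseAll []             = [] , refl , []
chooseAll ((y , q) ∷ qs) =
  let ps , eq , all = chooseAll qs in (_ , y) ∷ ps , cong (_ ∷_) eq , q ∷ all

length-filter-split : {P : Pred A p} (P? : Decidable P) → ∀ xs →
                      length xs ≡ length (filter P? xs) + length (filter (¬? ∘ P?) xs)
length-filter-split P? []       = refl
length-filter-split P? (x ∷ xs) with P? x
... | yes _ = cong suc (length-filter-split P? xs)
... | no _  = trans (cong suc (length-filter-split P? xs)) (sym (ℕₚ.+-suc _ _))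

injection⇒≤length : ∀ {m} (f : Fin m → A) → Injective _≡_ _≡_ f → ∀ {xs} →
                    (∀ i → f i ∈ xs) → m ≤ length xs
injection⇒≤length f inj {xs} f∈ = injective⇒≤ {f = λ i → Any.index (f∈ i)} λ {i} {j} eq →
  inj (trans (lookup-index (f∈ i)) (trans (cong (lookup xs) eq) (sym (lookup-index (f∈ j)))))

sumBelow : (ℕ → ℕ) → ℕ → ℕ
sumBelow F zero    = 0
sumBelow F (suc k) = F k + sumBelow F k

-- Turns a bound for every single level into one for all levels below `k`: the elements of top rank
-- are split off and counted by `F`.
length≤sumBelow : {P : Pred A p} (rank : A → ℕ) (F : ℕ → ℕ) →
  (∀ d xs → Unique xs → All P xs → All (λ x → rank x ≡ d) xs → length xs ≤ F d) →
  ∀ k xs → Unique xs → All P xs → All (λ x → rank x < k) xs → length xs ≤ sumBelow F k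
length≤sumBelow rank F H zero    []      _ _  _        = z≤n
length≤sumBelow rank F H zero    (_ ∷ _) _ _  (() ∷ _)
length≤sumBelow rank F H (suc k) xs      u ps rk       = begin
  length xs                                                       ≡⟨ length-filter-split top? xs ⟩
  length (filter top? xs) + length (filter (¬? ∘ top?) xs)        ≤⟨ ℕₚ.+-mono-≤
    (H k _ (Unique.filter⁺ top? u) (Allₚ.filter⁺ top? ps) (Allₚ.all-filter top? xs))
    (length≤sumBelow rank F H k _ (Unique.filter⁺ (¬? ∘ top?) u) (Allₚ.filter⁺ (¬? ∘ top?) ps)
      (All.zipWith (λ (lt , ne) → ℕₚ.≤∧≢⇒< (ℕ.s≤s⁻¹ lt) ne)
        (Allₚ.filter⁺ (¬? ∘ top?) rk , Allₚ.all-filter (¬? ∘ top?) xs))) ⟩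
  F k + sumBelow F k                                              ∎
  where
  open ≤-Reasoning
  top? : Decidable (λ x → rank x ≡ k)
  top? x = rank x ℕ.≟ k

-- Ramsey's theorem and induced matchings, for lists

ramseyBound : ℕ → ℕ → ℕ
ramseyBound zero    _       = 0
ramseyBound (suc _) zero    = 0
ramseyBound (suc m) (suc n) = suc (ramseyBound m (suc n) + ramseyBound (suc m) n)

-- The Erdős-Szekeres recursion: the head `x` splits the tail into elements related and unrelated to
-- it, and one of the two parts is long enough to recurse. The `suc` in `ramseyBound` counts `x`.
ramsey : {R : Rel A r} → Binary.Decidable R → ∀ m n xs → ramseyBound m n ≤ length xs →
         (∃[ ys ] ys ⊆ xs × m ≤ length ys × AllPairs R ys)
         ⊎ (∃[ ys ] ys ⊆ xs × n ≤ length ys × AllPairs (λ x y → ¬ R x y) ys)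
ramsey R? zero    n       xs       le = inj₁ ([] , minimum xs , z≤n , [])
ramsey R? (suc m) zero    xs       le = inj₂ ([] , minimum xs , z≤n , [])
ramsey R? (suc m) (suc n) (x ∷ xs) (s≤s le)
  with ramseyBound m (suc n) ℕ.≤? length (filter (R? x) xs)
... | yes le₁ with ramsey R? m (suc n) (filter (R? x) xs) le₁
...   | inj₁ (ys , τ , l , ps) =
  inj₁ (x ∷ ys , refl ∷ ⊆-trans τ (filter-⊆ (R? x) xs) , s≤s l ,
        All-resp-⊆ τ (Allₚ.all-filter (R? x) xs) ∷ ps)
...   | inj₂ (ys , τ , l , ps) = inj₂ (ys , x ∷ʳ ⊆-trans τ (filter-⊆ (R? x) xs) , l , ps)
ramsey R? (suc m) (suc n) (x ∷ xs) (s≤s le) | no ¬le₁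
  with ramsey R? (suc m) n (filter (¬? ∘ R? x) xs)
         (ℕₚ.+-cancelˡ-≤ (length (filter (R? x) xs)) _ _
           (≤-trans (ℕₚ.+-monoˡ-≤ _ (ℕₚ.<⇒≤ (≰⇒> ¬le₁)))
             (≤-trans le (≤-reflexive (length-filter-split (R? x) xs)))))
...   | inj₁ (ys , τ , l , ps) = inj₁ (ys , x ∷ʳ ⊆-trans τ (filter-⊆ _ xs) , l , ps)
...   | inj₂ (ys , τ , l , ps) =
  inj₂ (x ∷ ys , refl ∷ ⊆-trans τ (filter-⊆ _ xs) , s≤s l ,
        All-resp-⊆ τ (Allₚ.all-filter (¬? ∘ R? x) xs) ∷ ps)

module _ {_~_ : A → B → Set r} (_~?_ : Binary.Decidable _~_) where

  -- Pairs `w ~ x` that are pairwise private form an induced matching between left and right ends.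
  Private : A × B → A × B → Set r
  Private (w , x) (w′ , x′) = ¬ w ~ x′ × ¬ w′ ~ x

  -- Thin out the cover `ws`: its head `w` is dropped if the rest still covers `xs`. Otherwise `w`
  -- has a private element; unless `w` is the centre of a star, its fewer than `n` elements are
  -- removed before recursing. Each pair kept thus costs at most `n` elements.
  star-or-matching : ∀ n ws xs → All (λ x → Any (_~ x) ws) xs →
    (∃₂ λ w ys → ys ⊆ xs × n ≤ length ys × All (w ~_) ys)
    ⊎ (∃[ ps ] length xs ≤ n * length ps
             × All (λ (w , x) → w ∈ ws × x ∈ xs × w ~ x) ps × AllPairs Private ps)
  star-or-matching n []       []      _        = inj₂ ([] , z≤n , [] , [])
  star-or-matching n []       (_ ∷ _) (() ∷ _)
  star-or-matching n (w ∷ ws) xs      cov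
    with All.all? (λ x → Any.any? (_~? x) ws) xs
  ... | yes cov′ with star-or-matching n ws xs cov′
  ...   | inj₁ star                    = inj₁ star
  ...   | inj₂ (ps , le , all , priv) =
    inj₂ (ps , le , All.map (λ (v∈ , rest) → there v∈ , rest) all , priv)
  star-or-matching n (w ∷ ws) xs cov | no ¬cov′
    with n ℕ.≤? length (filter (w ~?_) xs)
  ... | yes le =
    inj₁ (w , _ , filter-⊆ (w ~?_) xs , le , Allₚ.all-filter (w ~?_) xs)
  ... | no ¬le
    with star-or-matching n ws (filter (¬? ∘ (w ~?_)) xs)
           (All.zipWith (λ { (here w~x , w≁x) → contradiction w~x w≁x ; (there c , _) → c })
             (Allₚ.filter⁺ (¬? ∘ (w ~?_)) cov , Allₚ.all-filter (¬? ∘ (w ~?_)) xs))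
  ...   | inj₁ (v , ys , τ , rest) =
    inj₁ (v , ys , ⊆-trans τ (filter-⊆ (¬? ∘ (w ~?_)) xs) , rest)
  ...   | inj₂ (ps , le , all , priv)
    -- An element that `ws` misses becomes the partner of `w`: later left ends come from `ws`, and
    -- later right ends are unrelated to `w`.
    with x , x∈ , ¬c ← find (Allₚ.¬All⇒Any¬ (λ x → Any.any? (_~? x) ws) xs ¬cov′)
    with All.lookup cov x∈
  ...     | there c    = contradiction c ¬c
  ...     | here w~x   = inj₂
    ( (w , x) ∷ ps
    , bound
    , (here refl , x∈ , w~x)
      ∷ All.map (λ (v∈ , y∈ , v~y) → there v∈ , proj₁ (∈-filter⁻ (¬? ∘ (w ~?_)) y∈) , v~y) all
    , All.map (λ (v∈ , y∈ , _) → proj₂ (∈-filter⁻ (¬? ∘ (w ~?_)) {xs = xs} y∈)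
                               , λ v~x → ¬c (Any.map (λ { refl → v~x }) v∈)) all
      ∷ priv )
    where
    bound : length xs ≤ n * suc (length ps)
    bound = begin
      length xs                                     ≡⟨ length-filter-split (w ~?_) xs ⟩
      length (filter (w ~?_) xs) + length (filter (¬? ∘ (w ~?_)) xs)
        ≤⟨ ℕₚ.+-mono-≤ (ℕₚ.<⇒≤ (≰⇒> ¬le)) le ⟩
      n + n * length ps                             ≡⟨ sym (ℕₚ.*-suc n (length ps)) ⟩
      n * suc (length ps)                           ∎
      where open ≤-Reasoning

-- Induced subgraphs

T-ext : ∀ {x y} → (T x → T y) → (T y → T x) → x ≡ y
T-ext {false} {false} _ _ = refl
T-ext {false} {true}  _ g = ⊥-elim (g tt)
T-ext {true}  {false} f _ = ⊥-elim (f tt)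
T-ext {true}  {true}  _ _ = refl

adj-symmetric : ∀ G {u v} → Graph.Adj G u v → Graph.Adj G v u
adj-symmetric G {u} {v} = subst T (Graph.adj-sym G u v)

adj⇒≢ : ∀ G {u v} → Graph.Adj G u v → u ≢ v
adj⇒≢ G {u} e refl = subst T (Graph.adj-irrefl G u) e

≤ᵍ-trans : ∀ {F G H} → F ≤ᵍ G → G ≤ᵍ H → F ≤ᵍ H
≤ᵍ-trans (f , f-inj , f-adj) (g , g-inj , g-adj) =
  g ∘ f , f-inj ∘ g-inj , λ u v → trans (f-adj u v) (g-adj (f u) (f v))

-- One criterion for embedding both `K* n` and `K₁* n`: `x` places the base graph and `y` its
-- pendants.
attachPendants-≤ᵍ : ∀ H G {m} (p : Fin m → Graph.Vertex H)
  (x : Graph.Vertex H → Graph.Vertex G) (y : Fin m → Graph.Vertex G) →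
  Injective _≡_ _≡_ x → Injective _≡_ _≡_ y → (∀ u j → x u ≢ y j) →
  (∀ u v → Graph.adj H u v ≡ Graph.adj G (x u) (x v)) →
  (∀ u j → does (p j Fin.≟ u) ≡ Graph.adj G (x u) (y j)) →
  (∀ i j → ¬ Graph.Adj G (y i) (y j)) →
  attachPendants H p ≤ᵍ G
attachPendants-≤ᵍ H G {m} p x y x-inj y-inj x≢y adj-xx adj-xy adj-yy = f , f-inj , f-adj
  where
  h = Graph.order H
  f : Fin (h + m) → Graph.Vertex G
  f u = [ x , y ]′ (splitAt h u)
  [x,y]-inj : ∀ s t → [ x , y ]′ s ≡ [ x , y ]′ t → s ≡ t
  [x,y]-inj (inj₁ u) (inj₁ v) eq = cong inj₁ (x-inj eq)
  [x,y]-inj (inj₁ u) (inj₂ j) eq = contradiction eq (x≢y u j)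
  [x,y]-inj (inj₂ i) (inj₁ v) eq = contradiction (sym eq) (x≢y v i)
  [x,y]-inj (inj₂ i) (inj₂ j) eq = cong inj₂ (y-inj eq)
  f-inj : Injective _≡_ _≡_ f
  f-inj {u} {v} eq = trans (sym (join-splitAt h m u))
    (trans (cong (Fin.join h m) ([x,y]-inj (splitAt h u) (splitAt h v) eq)) (join-splitAt h m v))
  f-adj : ∀ u v → Graph.adj (attachPendants H p) u v ≡ Graph.adj G (f u) (f v)
  f-adj u v with splitAt h u | splitAt h v
  ... | inj₁ u′ | inj₁ v′ = adj-xx u′ v′
  ... | inj₁ u′ | inj₂ j  = adj-xy u′ j
  ... | inj₂ i  | inj₁ v′ = trans (adj-xy v′ i) (Graph.adj-sym G _ _)
  ... | inj₂ i  | inj₂ j  = T-ext ⊥-elim (adj-yy i j)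

-- Distance layers of a connected graph

-- These are the only properties of distance from `root` that are used. By symmetry of adjacency,
-- `lvl-≤` bounds the level difference along an edge in both directions.
record Layering (G : Graph) : Set where
  open Graph G
  field
    root   : Vertex
    lvl    : Vertex → ℕ
    lvl≡0  : ∀ {v} → lvl v ≡ 0 → v ≡ root
    parent : ∀ {v d} → lvl v ≡ suc d → ∃[ u ] lvl u ≡ d × Adj u v
    lvl-≤  : ∀ {u v} → Adj u v → lvl v ≤ suc (lvl u)

least : {P : ℕ → Set p} → Decidable P → ∀ {n} → P n →
        ∃[ k ] P k × (∀ {j} → j < k → ¬ P j)
least         P? {zero}  pn = 0 , pn , λ ()
least {P = P} P? {suc n} pn with P? 0
... | yes p0 = 0 , p0 , λ ()
... | no ¬p0 with k , pk , min ← least (P? ∘ suc) pn =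
  suc k , pk , λ { {zero} _ → ¬p0 ; {suc j} (s≤s j<k) → min j<k }

module _ (G : Graph) (connected : Connected G) (r : Graph.Vertex G) where
  open Graph G hiding (Connected)

  private
    -- Prescribing the exact length makes walks decidable by recursion, so `least` can extract the
    -- distance.
    Walk : ℕ → Vertex → Set
    Walk zero    v = v ≡ r
    Walk (suc k) v = ∃[ u ] Walk k u × Adj u v

    walk? : ∀ k → Decidable (Walk k)
    walk? zero    v = v Fin.≟ r
    walk? (suc k) v = any? λ u → walk? k u ×-dec T? (adj u v)

    extend : ∀ {u v k} → Walk k u → Reachable u v → ∃[ l ] Walk l v
    extend w ε       = _ , w
    extend w (e ◅ s) = extend (_ , w , e) s

    distance : ∀ v → ∃[ k ] Walk k v × (∀ {j} → j < k → ¬ Walk j v)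
    distance v = least (λ k → walk? k v) (proj₂ (extend {k = 0} refl (connected r v)))

    dist : Vertex → ℕ
    dist v = proj₁ (distance v)

    walk : ∀ v → Walk (dist v) v
    walk v = proj₁ (proj₂ (distance v))

    dist-≤ : ∀ {v k} → Walk k v → dist v ≤ k
    dist-≤ {v} w = ≮⇒≥ λ k<dist → proj₂ (proj₂ (distance v)) k<dist w

    dist-adj : ∀ {u v} → Adj u v → dist v ≤ suc (dist u)
    dist-adj {u} e = dist-≤ (u , walk u , e)

  distanceLayering : Layering G
  distanceLayering = record
    { root   = r
    ; lvl    = dist
    ; lvl≡0  = λ {v} eq → subst (λ k → Walk k v) eq (walk v)
    -- The last vertex before `v` on a shortest walk: the walk bounds its distance from above, the
    -- edge to `v` from below.
    ; parent = λ {v} {d} eq →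
        let u , w , e = subst (λ k → Walk k v) eq (walk v)
        in u , ≤-antisym (dist-≤ w) (ℕ.s≤s⁻¹ (≤-trans (≤-reflexive (sym eq)) (dist-adj e))) , e
    ; lvl-≤  = dist-adj
    }

-- Two rungs with distinct upper ends are already impossible at level 0. At level `suc d` the factor
-- `n` pays for the loss in `star-or-matching`.
rungBound : ℕ → ℕ → ℕ
rungBound n zero    = 2
rungBound n (suc d) = ramseyBound n (n * rungBound n d)

module _ {G : Graph} (L : Layering G) where
  open Graph G hiding (Connected)
  open Layering L

  -- Parents are followed up to the root, where the sequence stays; only indices up to `k` matter.
  -- Stating levels as a sum avoids truncated subtraction.
  descent : ∀ k v → lvl v ≡ k →
    Σ[ q ∈ (ℕ → Vertex) ] q 0 ≡ v × (∀ i → i ≤ k → lvl (q i) + i ≡ k)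
                          × (∀ i → i < k → Adj (q (suc i)) (q i))
  descent zero    v eq = (λ _ → v) , refl , (λ { zero z≤n → trans (ℕₚ.+-identityʳ _) eq }) , λ _ ()
  descent (suc k) v eq with u , lvl-u , e ← parent eq
    with q , refl , lvl-q , adj-q ← descent k u lvl-u =
      (λ { zero → v ; (suc i) → q i })
    , refl
    , (λ { zero _ → trans (ℕₚ.+-identityʳ _) eq
         ; (suc i) (s≤s i≤k) → trans (ℕₚ.+-suc _ i) (cong suc (lvl-q i i≤k)) })
    , λ { zero _ → e ; (suc i) (s≤s i<k) → adj-q i i<k }

  -- A descent is an induced path: its levels drop by exactly one per step, while an edge changes
  -- the level by at most one.
  deep⇒P≤ᵍ : ∀ {n v} → n ≤ lvl v → P n ≤ᵍ G
  deep⇒P≤ᵍ {n} {v} n≤ with q , _ , lvl-q , adj-q ← descent (lvl v) v refl =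
    q ∘ toℕ , (λ {i} {j} → f-inj i j) , λ i j → T-ext (to i j) (from i j)
    where
    AdjP = Graph.Adj (P n)
    below : ∀ (i : Fin n) → toℕ i < lvl v
    below i = ℕₚ.<-≤-trans (toℕ<n i) n≤
    level : ∀ (i : Fin n) → lvl (q (toℕ i)) + toℕ i ≡ lvl v
    level i = lvl-q (toℕ i) (ℕₚ.<⇒≤ (below i))
    f-inj : ∀ i j → q (toℕ i) ≡ q (toℕ j) → i ≡ j
    f-inj i j eq = toℕ-injective (ℕₚ.+-cancelˡ-≡ (lvl (q (toℕ j))) _ _
      (trans (cong (λ u → lvl u + toℕ i) (sym eq)) (trans (level i) (sym (level j)))))
    step : ∀ i j → suc (toℕ i) ≡ toℕ j → Adj (q (toℕ j)) (q (toℕ i))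
    step i j eq rewrite sym eq = adj-q (toℕ i) (below i)
    to : ∀ i j → AdjP i j → Adj (q (toℕ i)) (q (toℕ j))
    to i j e with Equivalence.to T-∨ e
    ... | inj₁ e′ = adj-symmetric G (step i j (ℕₚ.≡ᵇ⇒≡ _ _ e′))
    ... | inj₂ e′ = step j i (ℕₚ.≡ᵇ⇒≡ _ _ e′)
    close : ∀ i j → Adj (q (toℕ j)) (q (toℕ i)) → toℕ j ≤ suc (toℕ i)
    close i j e = ℕₚ.+-cancelˡ-≤ (lvl (q (toℕ j))) _ _ (begin
      lvl (q (toℕ j)) + toℕ j         ≡⟨ trans (level j) (sym (level i)) ⟩
      lvl (q (toℕ i)) + toℕ i         ≤⟨ ℕₚ.+-monoˡ-≤ (toℕ i) (lvl-≤ e) ⟩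
      suc (lvl (q (toℕ j)) + toℕ i)   ≡⟨ sym (ℕₚ.+-suc _ (toℕ i)) ⟩
      lvl (q (toℕ j)) + suc (toℕ i)   ∎)
      where open ≤-Reasoning
    from : ∀ i j → Adj (q (toℕ i)) (q (toℕ j)) → AdjP i j
    from i j e with ℕₚ.<-cmp (toℕ i) (toℕ j)
    ... | tri< i<j _ _ = Equivalence.from T-∨
      (inj₁ (ℕₚ.≡⇒≡ᵇ _ _ (≤-antisym i<j (close i j (adj-symmetric G e)))))
    ... | tri≈ _ i≡j _ = contradiction (cong q i≡j) (adj⇒≢ G e)
    ... | tri> _ _ j<i = Equivalence.from T-∨
      (inj₂ (ℕₚ.≡⇒≡ᵇ _ _ (≤-antisym j<i (close j i e))))

  -- Rungs: induced matchings between consecutive levels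

  Rung : ℕ → Vertex × Vertex → Set
  Rung d (x , y) = lvl x ≡ d × lvl y ≡ suc d × Adj x y

  -- Together with Rung, the second and third components force y ≢ y′ too.
  Apart : Vertex × Vertex → Vertex × Vertex → Set
  Apart (x , y) (x′ , y′) = x ≢ x′ × ¬ Adj x y′ × ¬ Adj x′ y × ¬ Adj y y′

  apart-sym : Symmetric Apart
  apart-sym (a , b , c , d) = ≢-sym a , c , b , d ∘ adj-symmetric G

  module _ {n d ps} (n≤ : n ≤ length ps) (rungs : All (Rung d) ps) (apart : AllPairs Apart ps)
    where

    private
      -- The list may be longer than `n`; its first `n` pairs are taken.
      at : Fin n → Vertex × Vertex
      at i = lookup ps (inject≤ i n≤)
      x y : Fin n → Vertex
      x = proj₁ ∘ at
      y = proj₂ ∘ at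

      at-pairs : {R : Rel (Vertex × Vertex) 0ℓ} → Symmetric R → AllPairs R ps →
                 ∀ {i j} → i ≢ j → R (at i) (at j)
      at-pairs sy rs i≢j = allPairs-lookup sy rs (i≢j ∘ inject≤-injective n≤ n≤ _ _)

      rung : ∀ i → Rung d (at i)
      rung i = All.lookup rungs (∈-lookup (inject≤ i n≤))

      at-apart : ∀ {i j} → i ≢ j → Apart (at i) (at j)
      at-apart = at-pairs apart-sym apart

      x-inj : Injective _≡_ _≡_ x
      x-inj {i} {j} eq = decidable-stable (i Fin.≟ j) λ i≢j → proj₁ (at-apart i≢j) eq

      y-inj : Injective _≡_ _≡_ y
      y-inj {i} {j} eq = decidable-stable (i Fin.≟ j) λ i≢j →
        proj₁ (proj₂ (at-apart i≢j)) (subst (Adj (x i)) eq (proj₂ (proj₂ (rung i))))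

      x≢y : ∀ i j → x i ≢ y j
      x≢y i j eq with lx , _ ← rung i | _ , ly , _ ← rung j =
        ℕₚ.1+n≢n (trans (sym ly) (trans (cong lvl (sym eq)) lx))

      adj-xy : ∀ i j → does (j Fin.≟ i) ≡ adj (x i) (y j)
      adj-xy i j with j Fin.≟ i
      ... | yes refl = T-ext (λ _ → proj₂ (proj₂ (rung i))) (λ _ → tt)
      ... | no j≢i   = T-ext ⊥-elim (proj₁ (proj₂ (at-apart (j≢i ∘ sym))))

      adj-yy : ∀ i j → ¬ Adj (y i) (y j)
      adj-yy i j with i Fin.≟ j
      ... | yes refl = λ e → adj⇒≢ G e refl
      ... | no i≢j   = proj₂ (proj₂ (proj₂ (at-apart i≢j)))

    clique⇒K*≤ᵍ : AllPairs (Adj on proj₁) ps → K* n ≤ᵍ G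
    clique⇒K*≤ᵍ clique = attachPendants-≤ᵍ (K n) G id x y x-inj y-inj x≢y adj-xx adj-xy adj-yy
      where
      adj-xx : ∀ i j → Graph.adj (K n) i j ≡ adj (x i) (x j)
      adj-xx i j with i Fin.≟ j
      ... | yes refl = sym (adj-irrefl (x i))
      ... | no i≢j   = T-ext (λ _ → at-pairs (adj-symmetric G) clique i≢j) (λ _ → tt)

    -- The centre `w` lies two levels above all lower ends, hence is neither equal nor adjacent to
    -- any of them.
    star⇒K₁*≤ᵍ : AllPairs (λ p q → ¬ Adj (proj₁ p) (proj₁ q)) ps →
                 ∀ {w} → All (λ p → suc (lvl w) ≡ d × Adj w (proj₁ p)) ps → K₁* n ≤ᵍ G
    star⇒K₁*≤ᵍ indep {w} centre =
      attachPendants-≤ᵍ (K₁ n) G suc x⁺ y (λ {u} {v} → x⁺-inj u v) y-inj x⁺≢y adj-xx adj-x⁺y adj-yy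
      where
      w∼x : ∀ i → suc (lvl w) ≡ d × Adj w (x i)
      w∼x i = All.lookup centre (∈-lookup (inject≤ i n≤))
      lvl-y : ∀ i → lvl (y i) ≡ suc (suc (lvl w))
      lvl-y i = trans (proj₁ (proj₂ (rung i))) (cong suc (sym (proj₁ (w∼x i))))
      x⁺ : Fin (suc n) → Vertex
      x⁺ zero    = w
      x⁺ (suc i) = x i
      x⁺-inj : ∀ u v → x⁺ u ≡ x⁺ v → u ≡ v
      x⁺-inj zero    zero    eq = refl
      x⁺-inj zero    (suc j) eq = contradiction eq (adj⇒≢ G (proj₂ (w∼x j)))
      x⁺-inj (suc i) zero    eq = contradiction (sym eq) (adj⇒≢ G (proj₂ (w∼x i)))
      x⁺-inj (suc i) (suc j) eq = cong suc (x-inj eq)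
      x⁺≢y : ∀ u j → x⁺ u ≢ y j
      x⁺≢y zero    j eq = ℕₚ.<⇒≢ (ℕₚ.m<n⇒m<1+n ≤-refl) (trans (cong lvl eq) (lvl-y j))
      x⁺≢y (suc i) j eq = x≢y i j eq
      adj-xx : ∀ u v → Graph.adj (K₁ n) u v ≡ adj (x⁺ u) (x⁺ v)
      adj-xx zero    zero    = sym (adj-irrefl w)
      adj-xx zero    (suc j) = T-ext (λ _ → proj₂ (w∼x j)) (λ _ → tt)
      adj-xx (suc i) zero    = T-ext (λ _ → adj-symmetric G (proj₂ (w∼x i))) (λ _ → tt)
      adj-xx (suc i) (suc j) with i Fin.≟ j
      ... | yes refl = sym (adj-irrefl (x i))
      ... | no i≢j   = T-ext ⊥-elim (at-pairs (_∘ adj-symmetric G) indep i≢j)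
      adj-x⁺y : ∀ u j → does (suc j Fin.≟ u) ≡ adj (x⁺ u) (y j)
      adj-x⁺y zero    j = T-ext ⊥-elim λ e →
        ℕₚ.1+n≰n (≤-trans (≤-reflexive (sym (lvl-y j))) (lvl-≤ e))
      adj-x⁺y (suc i) j = adj-xy i j

  private
    -- With the level included, a matching for this relation consists of rungs again, one level
    -- nearer the root.
    Above : ℕ → Vertex → Vertex × Vertex → Set
    Above d w (x , _) = lvl w ≡ d × Adj w x

    above? : ∀ d → Binary.Decidable (Above d)
    above? d w (x , _) = (lvl w ℕ.≟ d) ×-dec T? (adj w x)

  -- Ramsey leaves many rungs whose upper ends are independent; either many of these
  -- ends have a common parent, or an induced matching with parents gives many rungs
  -- one level closer to the root, where level 0 has room for one rung only.
  rungs⇒K*⊎K₁* : ∀ n .{{_ : ℕ.NonZero n}} d ps → All (Rung d) ps → AllPairs Apart ps →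
                 rungBound n d ≤ length ps → K* n ≤ᵍ G ⊎ K₁* n ≤ᵍ G
  rungs⇒K*⊎K₁* n zero (_ ∷ _ ∷ _) ((lx , _) ∷ (lx′ , _) ∷ _) (((x≢x′ , _) ∷ _) ∷ _) _ =
    contradiction (trans (lvl≡0 lx) (sym (lvl≡0 lx′))) x≢x′
  rungs⇒K*⊎K₁* n zero (_ ∷ []) _ _ (s≤s ())
  rungs⇒K*⊎K₁* n (suc d) ps rungs apart le
    with ramsey (λ p q → T? (adj (proj₁ p) (proj₁ q))) n (n * rungBound n d) ps le
  ... | inj₁ (qs , τ , n≤ , clique) =
    inj₁ (clique⇒K*≤ᵍ n≤ (All-resp-⊆ τ rungs) (allPairs-resp-⊆ τ apart) clique)
  ... | inj₂ (qs , τ , le′ , indep)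
    with star-or-matching (above? d) n (allFin order) qs
           (All.map (λ (lx , _) → let u , lu , e = parent lx in lose (∈-allFin u) (lu , e))
             (All-resp-⊆ τ rungs))
  ...   | inj₁ (w , zs , υ , n≤ , centre) =
    inj₂ (star⇒K₁*≤ᵍ n≤ (All-resp-⊆ υ (All-resp-⊆ τ rungs))
      (allPairs-resp-⊆ υ (allPairs-resp-⊆ τ apart))
      (allPairs-resp-⊆ υ indep) (All.map (λ (lw , e) → cong suc lw , e) centre))
  ...   | inj₂ (ms , le″ , matched , priv) =
    rungs⇒K*⊎K₁* n d (map shift ms)
      (Allₚ.map⁺ (All.map
        (λ (_ , p∈ , lw , e) → lw , proj₁ (All.lookup (All-resp-⊆ τ rungs) p∈) , e) matched))
      (AllPairsₚ.map⁺ (allPairs-map shift-apart matched priv))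
      -- The matching loses at most the factor `n` built into `rungBound`, and `n` is positive.
      (subst (rungBound n d ≤_) (sym (length-map shift ms))
        (ℕₚ.*-cancelˡ-≤ n (≤-trans le′ le″)))
    where
    shift : Vertex × (Vertex × Vertex) → Vertex × Vertex
    shift (w , (x , y)) = w , x
    Matched : Vertex × (Vertex × Vertex) → Set
    Matched (w , p) = w ∈ allFin order × p ∈ qs × Above d w p
    -- The old upper ends become lower ends, so their independence gives the last clause of `Apart`;
    -- privacy gives the others, and also `p ≢ p′`.
    shift-apart : ∀ {m m′} → Matched m → Matched m′ → Private (above? d) m m′ →
                  Apart (shift m) (shift m′)
    shift-apart {w , p} {w′ , p′} (_ , p∈ , lw , e) (_ , p′∈ , lw′ , e′) (w≁p′ , w′≁p) =
        (λ { refl → w≁p′ (lw′ , e′) })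
      , (λ f → w≁p′ (lw , f))
      , (λ f → w′≁p (lw′ , f))
      , allPairs-∈ (_∘ adj-symmetric G) indep p∈ p′∈ (λ { refl → w≁p′ (lw , e) })

-- Cut vertices

  Avoiding : Vertex → Vertex → Vertex → Set
  Avoiding v = Star (λ a b → a ≢ v × b ≢ v × Adj a b)

  -- For `v` equal to `root` every neighbour is shielded, since no avoiding walk can leave `root`.
  Shielded : Vertex → Vertex → Set
  Shielded v y = Adj v y × ¬ Avoiding v root y

  -- Climbing from `u` through parents meets only levels below `k`, hence never `v`.
  shallow-avoiding : ∀ k {u v} → lvl u ≡ k → u ≢ v → k ≤ lvl v → Avoiding v root u
  shallow-avoiding zero    lu u≢v _ rewrite lvl≡0 lu = ε
  shallow-avoiding (suc k) {u} {v} lu u≢v k<v with p , lp , e ← parent lu =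
    shallow-avoiding k lp p≢v (ℕₚ.<⇒≤ k<v) ◅◅ (p≢v , u≢v , e) ◅ ε
    where
    p≢v : p ≢ v
    p≢v refl = ℕₚ.<⇒≢ k<v (sym lp)

  shielded-lvl : ∀ {v y} → Shielded v y → lvl y ≡ suc (lvl v)
  shielded-lvl {v} {y} (e , unreachable) = ≤-antisym (lvl-≤ e)
    (≰⇒> λ y≤v → unreachable (shallow-avoiding _ refl (≢-sym (adj⇒≢ G e)) y≤v))

  -- Each edge to be excluded opens a detour: `v` is reachable without `v′`, so an edge from `v` or
  -- from `y` to `y′` would lead from the root to `y′` around `v′`.
  shielded-apart : ∀ {d v y v′ y′} → lvl v ≡ d → Shielded v y → lvl v′ ≡ d → Shielded v′ y′ →
                   v ≢ v′ → Apart (v , y) (v′ , y′)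
  shielded-apart {d} lv sh lv′ sh′ v≢v′ =
      v≢v′
    , pendant lv lv′ sh′ v≢v′
    , pendant lv′ lv sh (≢-sym v≢v′)
    , λ e → proj₂ sh′ (avoiding lv lv′ v≢v′ ◅◅
        (v≢v′ , shielded-≢ sh lv lv′ , proj₁ sh) ◅
        (shielded-≢ sh lv lv′ , ≢-sym (adj⇒≢ G (proj₁ sh′)) , e) ◅ ε)
    where
    avoiding : ∀ {u v} → lvl u ≡ d → lvl v ≡ d → u ≢ v → Avoiding v root u
    avoiding lu lv u≢v = shallow-avoiding _ refl u≢v (≤-reflexive (trans lu (sym lv)))
    shielded-≢ : ∀ {u y v} → Shielded u y → lvl u ≡ d → lvl v ≡ d → y ≢ v
    shielded-≢ sh lu lv refl =
      ℕₚ.1+n≢n (trans (cong suc (sym lu)) (trans (sym (shielded-lvl sh)) lv))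
    pendant : ∀ {u v y} → lvl u ≡ d → lvl v ≡ d → Shielded v y → u ≢ v → ¬ Adj u y
    pendant lu lv (e′ , unreachable) u≢v e =
      unreachable (avoiding lu lv u≢v ◅◅ (u≢v , ≢-sym (adj⇒≢ G e′) , e) ◅ ε)

  -- One shielded neighbour per vertex turns the level into pairwise apart rungs.
  shielding-level≤ : ∀ n .{{_ : ℕ.NonZero n}} → ¬ K* n ≤ᵍ G → ¬ K₁* n ≤ᵍ G →
    ∀ d vs → Unique vs → All (∃ ∘ Shielded) vs → All (λ v → lvl v ≡ d) vs →
    length vs ≤ rungBound n d
  shielding-level≤ n ¬K* ¬K₁* d vs uniq shielded levels with chooseAll shielded
  ... | ps , refl , all = ℕₚ.≮⇒≥ λ lt →
    [ ¬K* , ¬K₁* ]′ (rungs⇒K*⊎K₁* n d ps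
      (All.zipWith (λ (sh , lv) → lv , trans (shielded-lvl sh) (cong suc lv) , proj₁ sh)
        (all , levels′))
      (allPairs-map (λ (sh , lv) (sh′ , lv′) → shielded-apart lv sh lv′ sh′)
        (All.zip (all , levels′)) (AllPairsₚ.map⁻ uniq))
      (≤-trans (ℕₚ.<⇒≤ lt) (≤-reflexive (length-map proj₁ ps))))
    where
    levels′ : All (λ p → lvl (proj₁ p) ≡ d) ps
    levels′ = Allₚ.map⁻ levels

cutVertexBound : ℕ → ℕ
cutVertexBound n = sumBelow (rungBound n) n

length-deduplicate≤1 : {R : Rel A r} (R? : Binary.Decidable R) → (∀ x y → R x y) →
                       ∀ xs → length (deduplicate R? xs) ≤ 1
length-deduplicate≤1 R? all []       = z≤n
length-deduplicate≤1 R? all (x ∷ xs) = s≤s (≤-reflexive (cong length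
  (filter-none (¬? ∘ R? x) (All.universal (λ y ¬r → ¬r (all x y)) (deduplicate R? xs)))))

connected⇒c≤1 : ∀ G → Connected G → c G ≤ 1
connected⇒c≤1 G connected = length-deduplicate≤1 (reachable? G) connected (allFin (Graph.order G))

connected⇒c≡1 : ∀ G → Connected G → Graph.Vertex G → c G ≡ 1
connected⇒c≡1 G@(record { order = suc _ }) connected _ =
  ≤-antisym (connected⇒c≤1 G connected) (s≤s z≤n)

short-overlap : {P : Pred A p} {Q : Pred A r} → ∀ {xs} → length xs ≤ 1 →
                Any P xs → Any Q xs → ∃[ x ] P x × Q x
short-overlap {xs = x ∷ []}    _        (here px) (here qx) = x , px , qx
short-overlap {xs = _ ∷ _ ∷ _} (s≤s ()) _         _

-- Deduplication keeps a representative of each component; a single one would link `u` to `v`.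
unreachable⇒1<c : ∀ G {u v} → ¬ Graph.Reachable G u v → 1 < c G
unreachable⇒1<c G {u} {v} unreachable = ≰⇒> λ c≤1 →
  let z , zu , zv = short-overlap c≤1 (representative u) (representative v)
  in unreachable (reverse (adj-symmetric G) zu ◅◅ zv)
  where
  representative : ∀ w → Any (λ z → Graph.Reachable G z w)
                             (deduplicate (reachable? G) (allFin (Graph.order G)))
  representative w =
    deduplicate⁺ (reachable? G) (λ yx xw → yx ◅◅ xw) (Any.map (λ { refl → ε }) (∈-allFin w))

adh≡c : ∀ G → Connected G → (v : Graph.Vertex G) → adh G v ≡ + c (G - v)
adh≡c G connected v rewrite connected⇒c≡1 G connected v =
  trans (ℤₚ.+-assoc (+ c (G - v)) (ℤ.- + 1) (+ 1)) (ℤₚ.+-identityʳ _)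

-- `G - v` reduces only when the order is visibly a successor; packaging the inclusion here confines
-- that case split to one place.
deletion : ∀ G v → Σ[ f ∈ (Graph.Vertex (G - v) → Graph.Vertex G) ]
  Injective _≡_ _≡_ f × (∀ a → f a ≢ v) × (∀ u → u ≢ v → ∃[ a ] f a ≡ u)
  × (∀ a b → Graph.adj (G - v) a b ≡ Graph.adj G (f a) (f b))
deletion (record { order = suc _ }) v =
    punchIn v
  , punchIn-injective v _ _
  , punchInᵢ≢i v
  , (λ u u≢v → punchOut (≢-sym u≢v) , punchIn-punchOut (≢-sym u≢v))
  , λ _ _ → refl

-- `S` is a union of components of `G - v` apart from `v`, so no walk there leads from `a` to `b`.
separated⇒cut : ∀ G → Connected G → ∀ {v} (S : Pred (Graph.Vertex G) p) →
  (∀ {a b} → a ≢ v → b ≢ v → Graph.Adj G a b → S a → S b) →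
  ∀ {a b} → a ≢ v → S a → b ≢ v → ¬ S b → + 2 ℤ.≤ adh G v
separated⇒cut G connected {v} S closed a≢v Sa b≢v ¬Sb
  with f , _ , f≢v , f-onto , f-adj ← deletion G v
  with a , refl ← f-onto _ a≢v | b , refl ← f-onto _ b≢v
  rewrite adh≡c G connected v = +≤+ (unreachable⇒1<c (G - v) λ s → ¬Sb (propagate s Sa))
  where
  propagate : ∀ {a b} → Graph.Reachable (G - v) a b → S (f a) → S (f b)
  propagate ε              Sa = Sa
  propagate {a} (e ◅ s) Sa = propagate s (closed (f≢v a) (f≢v _) (subst T (f-adj a _) e) Sa)

-- If `v` shielded nothing, every other vertex could be reached from the root without `v`, and
-- `G - v` would be connected.
cut⇒shielded : ExcludedMiddle 0ℓ → ∀ {G} → Connected G → (L : Layering G) →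
               ∀ {v} → + 2 ℤ.≤ adh G v → ∃ (Shielded L v)
cut⇒shielded em {G} connected L {v} cut
  with f , f-inj , f≢v , f-onto , f-adj ← deletion G v = decidable-stable em λ ¬shielded →
    <-irrefl refl (≤-trans 1<c (connected⇒c≤1 (G - v) λ a b →
      restrict
        (reverse (λ (a≢v , b≢v , e) → b≢v , a≢v , adj-symmetric G e)
          (avoid ¬shielded (connected (f a) v) (f≢v a))
         ◅◅ avoid ¬shielded (connected (f b) v) (f≢v b))
        refl refl))
  where
  open Graph G hiding (Connected)
  open Layering L
  1<c : 1 < c (G - v)
  1<c = ℤₚ.drop‿+≤+ (subst (+ 2 ℤ.≤_) (adh≡c G connected v) cut)
  restrict : ∀ {x y} → Avoiding L v x y → ∀ {a b} → f a ≡ x → f b ≡ y → Graph.Reachable (G - v) a b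
  restrict ε               fa fb with refl ← f-inj (trans fa (sym fb)) = ε
  restrict ((_ , w≢v , e) ◅ s) {a} refl fb with w , refl ← f-onto _ w≢v =
    subst T (sym (f-adj a w)) e ◅ restrict s refl fb
  avoid : ¬ ∃ (Shielded L v) → ∀ {z} → Reachable z v → z ≢ v → Avoiding L v root z
  avoid ¬sh ε z≢v = contradiction refl z≢v
  avoid ¬sh {z} (_◅_ {j = w} e s) z≢v with w Fin.≟ v
  -- The walk is about to enter `v`, so `z` is a neighbour of `v` and, not being shielded, is
  -- reached from the root.
  ... | yes refl = decidable-stable em λ ¬av → ¬sh (z , adj-symmetric G e , ¬av)
  ... | no w≢v   = avoid ¬sh s w≢v ◅◅ (w≢v , z≢v , adj-symmetric G e) ◅ ε

#cutVertices≤ : ExcludedMiddle 0ℓ → ∀ n .{{_ : ℕ.NonZero n}} → ∀ G → Connected G →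
                ¬ K* n ≤ᵍ G → ¬ K₁* n ≤ᵍ G → ¬ P n ≤ᵍ G → #cutVertices G ≤ cutVertexBound n
#cutVertices≤ em n (record { order = zero }) _ _ _ _ = z≤n
#cutVertices≤ em n G@(record { order = suc _ }) connected ¬K* ¬K₁* ¬P =
  length≤sumBelow lvl (rungBound n) (shielding-level≤ L n ¬K* ¬K₁*) n _
    (Unique.filter⁺ cut? (Unique.allFin⁺ _))
    (All.map (cut⇒shielded em connected L) (Allₚ.all-filter cut? (allFin _)))
    (All.universal (λ v → ≰⇒> (¬P ∘ deep⇒P≤ᵍ L {v = v})) _)
  where
  L = distanceLayering G connected zero
  open Layering L
  cut? = λ v → + 2 ℤ.≤? adh G v

≤#cutVertices : ∀ G {m} (g : Fin m → Graph.Vertex G) → Injective _≡_ _≡_ g →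
                (∀ i → + 2 ℤ.≤ adh G (g i)) → m ≤ #cutVertices G
≤#cutVertices G g g-inj cut = injection⇒≤length g g-inj
  λ i → ∈-filter⁺ (λ v → + 2 ℤ.≤? adh G v) (∈-allFin (g i)) (cut i)

-- The three obstructions

connected-from : ∀ G r → (∀ v → Graph.Reachable G r v) → Connected G
connected-from G r reach u v = reverse (adj-symmetric G) (reach u) ◅◅ reach v

K-connected : ∀ n → Connected (K n)
K-connected n u v with u Fin.≟ v in eq
... | yes refl = ε
... | no u≢v   = subst (T ∘ not ∘ does) (sym eq) tt ◅ ε

K₁-connected : ∀ n → Connected (K₁ n)
K₁-connected n = connected-from (K₁ n) zero λ { zero → ε ; (suc _) → tt ◅ ε }

next-adj : ∀ {n} (i : Fin n) → Graph.Adj (P (suc n)) (inject₁ i) (suc i)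
next-adj i = Equivalence.from T-∨ (inj₁ (ℕₚ.≡⇒≡ᵇ _ _ (cong suc (toℕ-inject₁ i))))

P-connected : ∀ n → Connected (P (suc n))
P-connected n = connected-from (P (suc n)) zero
  (<-weakInduction (Graph.Reachable (P (suc n)) zero) ε λ i s → s ◅◅ next-adj i ◅ ε)

module _ (H : Graph) {m} (p : Fin m → Graph.Vertex H) where
  private
    h = Graph.order H
    H* = attachPendants H p
    open Graph H* using (Adj; Reachable)

  old-adj : ∀ u v → Graph.Adj H u v → Adj (u ↑ˡ m) (v ↑ˡ m)
  old-adj u v e rewrite splitAt-↑ˡ h u m | splitAt-↑ˡ h v m = e

  pendant-adj : ∀ j → Adj (p j ↑ˡ m) (h ↑ʳ j)
  pendant-adj j rewrite splitAt-↑ˡ h (p j) m | splitAt-↑ʳ h m j | dec-true (p j Fin.≟ p j) refl = tt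

  pendant-adj⁻ : ∀ {j v} → Adj (h ↑ʳ j) v → p j ↑ˡ m ≡ v
  pendant-adj⁻ {j} {v} e rewrite splitAt-↑ʳ h m j with splitAt h v in eq
  ... | inj₁ u with p j Fin.≟ u
  ...   | yes refl = splitAt⁻¹-↑ˡ eq

  attachPendants-connected : Connected H → Connected H*
  attachPendants-connected connected a b =
    via (splitAt h a) (splitAt h b) (join-splitAt h m a) (join-splitAt h m b)
    where
    old : ∀ {u v} → Graph.Reachable H u v → Reachable (u ↑ˡ m) (v ↑ˡ m)
    old ε       = ε
    old (e ◅ s) = old-adj _ _ e ◅ old s
    to-old : ∀ s → ∃[ u ] Reachable (u ↑ˡ m) (Fin.join h m s)
    to-old (inj₁ u) = u , ε
    to-old (inj₂ j) = p j , pendant-adj j ◅ ε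
    via : ∀ {a b} s t → Fin.join h m s ≡ a → Fin.join h m t ≡ b → Reachable a b
    via s t refl refl =
      let u , su = to-old s ; v , tv = to-old t
      in reverse (adj-symmetric H*) su ◅◅ old (connected u v) ◅◅ tv

  -- Deleting `p j` isolates its pendant, while `u` survives on the other side.
  attachPendants-cut : Connected H → ∀ j {u} → u ≢ p j → + 2 ℤ.≤ adh H* (p j ↑ˡ m)
  attachPendants-cut connected j {u} u≢p =
    separated⇒cut H* (attachPendants-connected connected) (_≡ h ↑ʳ j)
      (λ { _ b≢p e refl → contradiction (sym (pendant-adj⁻ e)) b≢p })
      (↑ʳ≢↑ˡ j) refl (u≢p ∘ ↑ˡ-injective m _ _) (≢-sym (↑ʳ≢↑ˡ j))
    where
    ↑ʳ≢↑ˡ : ∀ j {u} → h ↑ʳ j ≢ u ↑ˡ m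
    ↑ʳ≢↑ˡ j {u} eq
      with () ← trans (sym (splitAt-↑ʳ h m j)) (trans (cong (splitAt h) eq) (splitAt-↑ˡ h u m))

  attachPendants-#cutVertices : Connected H → Injective _≡_ _≡_ p → (∀ j → ∃[ u ] u ≢ p j) →
                                m ≤ #cutVertices H*
  attachPendants-#cutVertices connected p-inj other = ≤#cutVertices H* (λ j → p j ↑ˡ m)
    (p-inj ∘ ↑ˡ-injective m _ _) λ j → attachPendants-cut connected j (proj₂ (other j))

-- The shift by 2 provides a second clique vertex; `K* 1` is a single edge and has no cut vertex.
K*-#cutVertices : ∀ n → 2 + n ≤ #cutVertices (K* (2 + n))
K*-#cutVertices n = attachPendants-#cutVertices (K (2 + n)) id (K-connected _) id
  λ { zero → suc zero , λ () ; (suc _) → zero , λ () }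

K₁*-#cutVertices : ∀ n → n ≤ #cutVertices (K₁* n)
K₁*-#cutVertices n = attachPendants-#cutVertices (K₁ n) suc (K₁-connected n) suc-injective
  λ _ → zero , λ ()

-- `suc ∘ inject₁` runs through the inner vertices; each separates the vertices before it, among
-- them the first, from the last one.
P-#cutVertices : ∀ n → n ≤ #cutVertices (P (2 + n))
P-#cutVertices n = ≤#cutVertices (P (2 + n)) (suc ∘ inject₁) (inject₁-injective ∘ suc-injective) λ i →
  separated⇒cut (P (2 + n)) (P-connected _) (λ u → toℕ u < suc (toℕ (inject₁ i)))
    (λ {a} {b} a≢ b≢ e a< → before (suc (inject₁ i)) a≢ b≢ e a<)
    {zero} {Fin.fromℕ (suc n)} (λ ()) (s≤s z≤n) (last≢ i) λ lt → last≮ i lt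
  where
  before : ∀ v {a b} → a ≢ v → b ≢ v → Graph.Adj (P (2 + n)) a b → toℕ a < toℕ v → toℕ b < toℕ v
  before v {a} {b} _ b≢v e a<v with Equivalence.to T-∨ e
  ... | inj₁ e′ = ℕₚ.≤∧≢⇒< (subst (_≤ toℕ v) (ℕₚ.≡ᵇ⇒≡ _ _ e′) a<v) (b≢v ∘ toℕ-injective)
  ... | inj₂ e′ = ℕₚ.<-trans (ℕₚ.≤-reflexive (ℕₚ.≡ᵇ⇒≡ _ _ e′)) a<v
  last≮ : ∀ i → ¬ toℕ (Fin.fromℕ (suc n)) < suc (toℕ (inject₁ i))
  last≮ i rewrite toℕ-fromℕ n | toℕ-inject₁ i = λ lt → ℕₚ.<-asym (toℕ<n i) (ℕ.s≤s⁻¹ lt)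
  last≢ : ∀ i → Fin.fromℕ (suc n) ≢ suc (inject₁ i)
  last≢ i eq = ℕₚ.<⇒≢ (toℕ<n i) (trans (sym (toℕ-inject₁ i))
    (trans (cong toℕ (sym (suc-injective eq))) (toℕ-fromℕ n)))

-- Boundedly many cut vertices and the three obstructions

theorem1p6 : ∀ {ℓ} → ExcludedMiddle ℓ → (𝓗 : Family ℓ) →
    (∃[ C ] (∀ (G : Graph) → Graph.Connected G → (𝓗 Free) G → #cutVertices G ≤ C))
    ⇔ (∃[ n ] (0 < n × 𝓗 ≤ᶠ ｛ K* n ｝ ∪ ｛ K₁* n ｝ ∪ ｛ P n ｝))
theorem1p6 {ℓ} em 𝓗 = mk⇔ necessary sufficient
  where
  em₀ : ExcludedMiddle 0ℓ
  em₀ = map′ lower lift (em {Lift ℓ _})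
  Bounded = ∃[ C ] (∀ G → Connected G → (𝓗 Free) G → #cutVertices G ≤ C)
  Unavoidable = λ n → ｛ K* n ｝ ∪ ｛ K₁* n ｝ ∪ ｛ P n ｝
  necessary : Bounded → ∃[ n ] (0 < n × 𝓗 ≤ᶠ Unavoidable n)
  -- The path dictates `3 + C`: without its two ends, `1 + C` cut vertices remain, just above the
  -- bound.
  necessary (C , bound) = 3 + C , s≤s z≤n , λ
    { _ (inj₁ refl)        → contained (K* (3 + C))
        (attachPendants-connected (K (3 + C)) id (K-connected (3 + C)))
        (≤-trans (ℕₚ.m≤n+m (suc C) 2) (K*-#cutVertices (suc C)))
    ; _ (inj₂ (inj₁ refl)) → contained (K₁* (3 + C))
        (attachPendants-connected (K₁ (3 + C)) suc (K₁-connected (3 + C)))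
        (≤-trans (ℕₚ.m≤n+m (suc C) 2) (K₁*-#cutVertices (3 + C)))
    ; _ (inj₂ (inj₂ refl)) → contained (P (3 + C)) (P-connected (2 + C)) (P-#cutVertices (suc C)) }
    where
    contained : ∀ G → Connected G → C < #cutVertices G → ∃[ H ] 𝓗 H × H ≤ᵍ G
    contained G connected C< =
      decidable-stable em λ free → ℕₚ.<⇒≱ C< (bound G connected free)
  sufficient : ∃[ n ] (0 < n × 𝓗 ≤ᶠ Unavoidable n) → Bounded
  sufficient (suc k , _ , 𝓗≤) = cutVertexBound (suc k) , bound
    where
    bound : ∀ G → Connected G → (𝓗 Free) G → #cutVertices G ≤ cutVertexBound (suc k)
    bound G connected free = #cutVertices≤ em₀ (suc k) G connected
      (excluded (K* (suc k)) (inj₁ refl)) (excluded (K₁* (suc k)) (inj₂ (inj₁ refl)))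
      (excluded (P (suc k)) (inj₂ (inj₂ refl)))
      where
      excluded : ∀ F → Unavoidable (suc k) F → ¬ F ≤ᵍ G
      -- A copy of `F` in `G` would contain a member of `𝓗`.
      excluded F F∈ F≤G with H , H∈ , H≤F ← 𝓗≤ F F∈ =
        free (H , H∈ , ≤ᵍ-trans {H} {F} {G} H≤F F≤G)
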